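{- Let $\Sigma$ be a signature, $\mathbf{K}$ a class of $\Sigma$-structures closed under subalgebras and $(Co_{\mathbf{K}},i)$ an equational filter pair having the theory lifting property. If $\mathbf{K}$ has the amalgamation property, then the logic associated to $(Co_{\mathbf{K}},i)$ has the Craig entailment interpolation property.
   Context: $Fm(X)$ is the absolutely free $\Sigma$-structure (formula algebra) on a set $X$ of variables; for $Z\subseteq X$ regard $Fm(Z)\subseteq Fm(X)$. A quasivariety is a class of $\Sigma$-structures axiomatizable by quasi-identities. $Co_{\mathbf{K}}(A)$ is the lattice of congruences $\theta$ on $A$ with $A/\theta\in\mathbf{K}$, ordered by inclusion. An equational filter pair is a pair $(Co_{\mathbf{K}},i)$ with $\mathbf{K}$ a quasivariety and $i_A:Co_{\mathbf{K}}(A)\to\mathcal{P}(A)$, $i_A(\theta)=\{a\in A\mid\langle\delta^A(a),\epsilon^A(a)\rangle\in\theta$ for all $\delta\approx\epsilon\in\tau\}$ for every $\Sigma$-structure $A$, where $\tau$ is a fixed finite set of equations in at most one variable. The associated logic with set of variables $X$, $(\Sigma,\vdash^X)$: for $\Gamma\cup\{\varphi\}\subseteq Fm(X)$, $\Gamma\vdash^X\varphi$ iff for all $\theta\in Co_{\mathbf{K}}(Fm(X))$, $\Gamma\subseteq i_{Fm(X)}(\theta)$ implies $\varphi\in i_{Fm(X)}(\theta)$. A theory in $Fm(X)$ is a $\vdash^X$-closed subset (equivalently, a set in the image of $i_{Fm(X)}$). Theory lifting property: for all sets $X,Y$ with $Z:=X\cap Y\neq\emptyset$ and every theory $T\subseteq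 Fm(X)$, putting $T'':=T\cap Fm(Z)$ and letting $T'\subseteq Fm(Y)$ be the smallest theory in $Fm(Y)$ containing $T''$, there exist $\theta_T\in Co_{\mathbf{K}}(Fm(X))$, $\theta_{T''}\in Co_{\mathbf{K}}(Fm(Z))$, $\theta_{T'}\in Co_{\mathbf{K}}(Fm(Y))$ with (a) $T=i(\theta_T)$, $T'=i(\theta_{T'})$, $T''=i(\theta_{T''})$, and (b) $\theta_T\cap Fm(Z)^2=\theta_{T''}=\theta_{T'}\cap Fm(Z)^2$. Amalgamation property of $\mathbf{K}$: for all $A,B,C\in\mathbf{K}$ and injective homomorphisms $i_B:A\to B$, $i_C:A\to C$ there are $D\in\mathbf{K}$ and injective homomorphisms $e_B:B\to D$, $e_C:C\to D$ with $e_B\circ i_B=e_C\circ i_C$. Craig entailment interpolation property of a logic: for every set of formulas $\Gamma$ and every formula $\varphi$, if $\Gamma\vdash\varphi$ then there is a set of formulas $\Gamma'$ with variables in $var(\Gamma)\cap var(\varphi)$ such that $\Gamma\vdash\gamma'$ for all $\gamma'\in\Gamma'$ and $\Gamma'\vdash\varphi$. Here $var$ denotes the set of variables occurring. -}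

module Defs where

open import Level using (Level; _⊔_) renaming (suc to lsuc)
open import Data.Fin.Base using (Fin)
open import Data.List.Base using (List)
open import Data.List.Relation.Unary.All using (All)
open import Data.Nat.Base using (ℕ)
open import Data.Product.Base using (_×_; proj₁; proj₂; ∃-syntax; Σ-syntax; uncurry)
open import Data.Unit.Base using (⊤)
open import Function.Base using (_on_; _∘_)
open import Function.Bundles using (_⇔_)
open import Function.Definitions using (Injective)
open import Relation.Binary.Bundles using (Setoid)
open import Relation.Binary.Core using (Rel; _⇒_) renaming (_⇔_ to _⇔ʳ_)
open import Relation.Binary.Structures using (IsEquivalence)
open import Relation.Unary using (Pred; _∈_; _⊆_; _∩_; _≐_; U; Satisfiable)

private
  variable
    ℓ k v p q : Level

------------------------------------------------------------------------
-- Σ-structures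

record Signature ℓ : Set (lsuc ℓ) where
  field
    Op    : Set ℓ
    arity : Op → ℕ

open Signature public

-- Carriers are setoids, so that quotients exist. A carrier may be empty, as
-- that of Fm(∅) is when there are no constants; the case of disjoint
-- variable sets in Craig interpolation depends on this.

record Algebra (𝕊 : Signature ℓ) : Set (lsuc ℓ) where
  field
    setoid : Setoid ℓ ℓ
  open Setoid setoid public
  field
    ⟦_⟧    : (o : Op 𝕊) → (Fin (arity 𝕊 o) → Carrier) → Carrier
    ⟦⟧-cong : ∀ o {as bs} → (∀ j → as j ≈ bs j) → ⟦ o ⟧ as ≈ ⟦ o ⟧ bs

record Hom {𝕊 : Signature ℓ} (A B : Algebra 𝕊) : Set ℓ where
  private
    module A = Algebra A
    module B = Algebra B
  field
    to     : A.Carrier → B.Carrier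
    cong   : ∀ {a b} → a A.≈ b → to a B.≈ to b
    homo   : ∀ o as → to (A.⟦ o ⟧ as) B.≈ B.⟦ o ⟧ (to ∘ as)

record Embedding {𝕊 : Signature ℓ} (A B : Algebra 𝕊) : Set ℓ where
  field
    hom       : Hom A B
  open Hom hom public
  field
    injective : Injective (Algebra._≈_ A) (Algebra._≈_ B) to

record IsCongruence {𝕊 : Signature ℓ} (A : Algebra 𝕊)
                    (θ : Rel (Algebra.Carrier A) ℓ) : Set ℓ where
  open Algebra A using (_≈_; ⟦_⟧)
  field
    reflexive     : _≈_ ⇒ θ
    isEquivalence : IsEquivalence θ
    compatible    : ∀ o {as bs} → (∀ j → θ (as j) (bs j)) → θ (⟦ o ⟧ as) (⟦ o ⟧ bs)

quotient : {𝕊 : Signature ℓ} (A : Algebra 𝕊) {θ : Rel (Algebra.Carrier A) ℓ} →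
           IsCongruence A θ → Algebra 𝕊
quotient A {θ} c = record
  { setoid  = record { Carrier = Algebra.Carrier A ; _≈_ = θ ; isEquivalence = isEquivalence }
  ; ⟦_⟧     = Algebra.⟦_⟧ A
  ; ⟦⟧-cong = compatible
  }
  where open IsCongruence c

------------------------------------------------------------------------
-- Formula algebras

-- A set of variables is a subset X of an ambient type V, which gives
-- meaning to X ∩ Y. Equality of formulas, _≋_, is syntactic identity: it
-- ignores the membership proofs and compares argument tuples pointwise.

data Fm (𝕊 : Signature ℓ) {V : Set v} (X : Pred V p) : Set (ℓ ⊔ v ⊔ p) where
  var : ∀ x → x ∈ X → Fm 𝕊 X
  op  : (o : Op 𝕊) → (Fin (arity 𝕊 o) → Fm 𝕊 X) → Fm 𝕊 X

module _ {𝕊 : Signature ℓ} {V : Set v} where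

  infix 4 _≋_

  data _≋_ {X : Pred V p} : Rel (Fm 𝕊 X) (ℓ ⊔ v ⊔ p) where
    var : ∀ {x m n} → var x m ≋ var x n
    op  : ∀ {o ts us} → (∀ j → ts j ≋ us j) → op o ts ≋ op o us

  ≋-isEquivalence : {X : Pred V p} → IsEquivalence (_≋_ {X = X})
  ≋-isEquivalence = record { refl = refl ; sym = sym ; trans = trans }
    where
    refl : ∀ {t} → t ≋ t
    refl {var x m} = var
    refl {op o ts} = op λ j → refl

    sym : ∀ {s t} → s ≋ t → t ≋ s
    sym var    = var
    sym (op e) = op λ j → sym (e j)

    trans : ∀ {s t u} → s ≋ t → t ≋ u → s ≋ u
    trans var    var    = var
    trans (op e) (op f) = op λ j → trans (e j) (f j)

  -- the inclusion Fm(X) ⊆ Fm(Y) for X ⊆ Y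
  incl : {X : Pred V p} {Y : Pred V q} → X ⊆ Y → Fm 𝕊 X → Fm 𝕊 Y
  incl X⊆Y (var x m) = var x (X⊆Y m)
  incl X⊆Y (op o ts) = op o λ j → incl X⊆Y (ts j)

  data Occurs {X : Pred V p} (x : V) : Fm 𝕊 X → Set (ℓ ⊔ v ⊔ p) where
    var : ∀ {m} → Occurs x (var x m)
    op  : ∀ {o ts} j → Occurs x (ts j) → Occurs x (op o ts)

  varOf : {X : Pred V p} → Fm 𝕊 X → Pred V (ℓ ⊔ v ⊔ p)
  varOf t x = Occurs x t

  varsOf : {X : Pred V p} → Pred (Fm 𝕊 X) q → Pred V (ℓ ⊔ v ⊔ p ⊔ q)
  varsOf Γ x = ∃[ γ ] (γ ∈ Γ × x ∈ varOf γ)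

FmAlg : (𝕊 : Signature ℓ) {V : Set ℓ} → Pred V ℓ → Algebra 𝕊
FmAlg 𝕊 X = record
  { setoid  = record { Carrier = Fm 𝕊 X ; _≈_ = _≋_ ; isEquivalence = ≋-isEquivalence }
  ; ⟦_⟧     = op
  ; ⟦⟧-cong = λ o → op
  }

Term : Signature ℓ → Set v → Set (ℓ ⊔ v)
Term 𝕊 V = Fm 𝕊 {V = V} U

module _ {𝕊 : Signature ℓ} (A : Algebra 𝕊) where
  open Algebra A

  eval : {V : Set v} → (V → Carrier) → Term 𝕊 V → Carrier
  eval ρ (var x _) = ρ x
  eval ρ (op o ts) = ⟦ o ⟧ λ j → eval ρ (ts j)

------------------------------------------------------------------------
-- Quasivarieties

Equation : Signature ℓ → Set v → Set (ℓ ⊔ v)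
Equation 𝕊 V = Term 𝕊 V × Term 𝕊 V

record QuasiIdentity (𝕊 : Signature ℓ) : Set ℓ where
  field
    premises   : List (Equation 𝕊 ℕ)
    conclusion : Equation 𝕊 ℕ

infix 4 _⊨_

_⊨_ : {𝕊 : Signature ℓ} → Algebra 𝕊 → QuasiIdentity 𝕊 → Set ℓ
_⊨_ {𝕊 = 𝕊} A qi = (ρ : ℕ → Carrier) → All (Holds ρ) premises → Holds ρ conclusion
  where
  open Algebra A
  open QuasiIdentity qi
  Holds : (ℕ → Carrier) → Equation 𝕊 ℕ → Set _
  Holds ρ = uncurry (_≈_ on eval A ρ)

IsQuasivariety : {𝕊 : Signature ℓ} → Pred (Algebra 𝕊) k → Set (lsuc ℓ ⊔ k)
IsQuasivariety {ℓ = ℓ} {𝕊 = 𝕊} K =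
  Σ[ Q ∈ Pred (QuasiIdentity 𝕊) ℓ ] (∀ A → A ∈ K ⇔ (∀ qi → qi ∈ Q → A ⊨ qi))

ClosedUnderSubalgebras : {𝕊 : Signature ℓ} → Pred (Algebra 𝕊) k → Set (lsuc ℓ ⊔ k)
ClosedUnderSubalgebras K = ∀ {A B} → Embedding A B → B ∈ K → A ∈ K

Amalgamation : {𝕊 : Signature ℓ} → Pred (Algebra 𝕊) k → Set (lsuc ℓ ⊔ k)
Amalgamation {𝕊 = 𝕊} K =
  ∀ {A B C : Algebra 𝕊} → A ∈ K → B ∈ K → C ∈ K →
  (iB : Embedding A B) (iC : Embedding A C) →
  Σ[ D ∈ Algebra 𝕊 ] Σ[ eB ∈ Embedding B D ] Σ[ eC ∈ Embedding C D ]
    (D ∈ K × (∀ a → Algebra._≈_ D (to eB (to iB a)) (to eC (to iC a))))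
  where open Embedding using (to)

-- an element of Co_K(A)

record Co {𝕊 : Signature ℓ} (K : Pred (Algebra 𝕊) k) (A : Algebra 𝕊)
          : Set (lsuc ℓ ⊔ k) where
  field
    rel          : Rel (Algebra.Carrier A) ℓ
    isCongruence : IsCongruence A rel
    quotient∈K   : quotient A isCongruence ∈ K

open Co public using (rel)

------------------------------------------------------------------------
-- Equational filter pairs and their logics

-- The congruence-filter pair is determined by K and τ. The equations of τ are
-- in at most one variable, the element of ⊤.

record EquationalFilterPair (𝕊 : Signature ℓ) k : Set (lsuc (ℓ ⊔ k)) where
  field
    K              : Pred (Algebra 𝕊) k
    isQuasivariety : IsQuasivariety K
    τ              : List (Equation 𝕊 ⊤)

  i : (A : Algebra 𝕊) → Co K A → Pred (Algebra.Carrier A) ℓ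
  i A θ a = All (uncurry (rel θ on eval A λ _ → a)) τ

  module _ {V : Set ℓ} {X : Pred V ℓ} where

    infix 4 _⊢_

    _⊢_ : Pred (Fm 𝕊 X) ℓ → Fm 𝕊 X → Set (lsuc ℓ ⊔ k)
    Γ ⊢ φ = (θ : Co K (FmAlg 𝕊 X)) → Γ ⊆ i (FmAlg 𝕊 X) θ → φ ∈ i (FmAlg 𝕊 X) θ

    IsTheory : Pred (Fm 𝕊 X) ℓ → Set (lsuc ℓ ⊔ k)
    IsTheory T = ∀ φ → T ⊢ φ → φ ∈ T

    IsTheoryGeneratedBy : Pred (Fm 𝕊 X) ℓ → Pred (Fm 𝕊 X) ℓ → Set (lsuc ℓ ⊔ k)
    IsTheoryGeneratedBy S T =
      IsTheory T × S ⊆ T × (∀ T₁ → IsTheory T₁ → S ⊆ T₁ → T ⊆ T₁)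

  TheoryLifting : Set (lsuc ℓ ⊔ k)
  TheoryLifting =
    ∀ (V : Set ℓ) (X Y : Pred V ℓ) → Satisfiable (X ∩ Y) →
    let Z = X ∩ Y
        ιX : Fm 𝕊 Z → Fm 𝕊 X
        ιX = incl proj₁
        ιY : Fm 𝕊 Z → Fm 𝕊 Y
        ιY = incl proj₂
    in
    ∀ (T : Pred (Fm 𝕊 X) ℓ) → IsTheory T →
    let T″ : Pred (Fm 𝕊 Z) ℓ
        T″ t = ιX t ∈ T
        ιY[T″] : Pred (Fm 𝕊 Y) ℓ
        ιY[T″] y = ∃[ t ] (t ∈ T″ × ιY t ≋ y)
    in
    ∀ (T′ : Pred (Fm 𝕊 Y) ℓ) → IsTheoryGeneratedBy ιY[T″] T′ →
    Σ[ θT ∈ Co K (FmAlg 𝕊 X) ] Σ[ θT″ ∈ Co K (FmAlg 𝕊 Z) ] Σ[ θT′ ∈ Co K (FmAlg 𝕊 Y) ]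
      ( (T  ≐ i (FmAlg 𝕊 X) θT)
      × (T′ ≐ i (FmAlg 𝕊 Y) θT′)
      × (T″ ≐ i (FmAlg 𝕊 Z) θT″)
      × ((rel θT on ιX) ⇔ʳ rel θT″)
      × (rel θT″ ⇔ʳ (rel θT′ on ιY)) )

CraigInterpolation : {𝕊 : Signature ℓ} {V : Set ℓ} {X : Pred V ℓ} →
                     (Pred (Fm 𝕊 X) ℓ → Fm 𝕊 X → Set q) → Set (lsuc ℓ ⊔ q)
CraigInterpolation {ℓ = ℓ} {𝕊 = 𝕊} {X = X} _⊢_ =
  ∀ (Γ : Pred (Fm 𝕊 X) ℓ) (φ : Fm 𝕊 X) → Γ ⊢ φ →
  Σ[ Γ′ ∈ Pred (Fm 𝕊 X) ℓ ]
    ( (varsOf Γ′ ⊆ varsOf Γ ∩ varOf φ)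
    × (∀ γ′ → γ′ ∈ Γ′ → Γ ⊢ γ′)
    × (Γ′ ⊢ φ) )

{-# OPTIONS --safe #-}

-- Let Z = var Γ ∩ var φ. The interpolant is the set of all consequences of Γ with
-- variables in Z. To see that it entails φ, take a K-congruence θ on Fm(X) whose
-- filter contains it. Theory lifting applied to var Γ and var φ gives a span of
-- quotients of formula algebras, which amalgamates in K; valuing the variables in
-- the amalgam and using Γ ⊢ φ shows that φ belongs to the theory generated by the
-- interpolant, hence to i(θ). Theory lifting needs a shared variable. If there is
-- some formula over Z, a fresh shared variable is added and later replaced by that
-- formula; if there is none, Fm(X)/⟨Γ⟩ and Fm(X)/θ amalgamate over an empty algebra.
--
-- These case distinctions, and the extension of a valuation from var Γ ∪ var φ to X,
-- are classical. As φ ∈ i(θ) is the only goal, they are made under the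
-- double-negation monad J P = (P → G) → G with G = (φ ∈ i(θ)), and all equalities
-- in the amalgam are read modulo J; quasi-identities survive because they involve
-- only finitely many formulas.

module Submission where

open import Level using (Level)
open import Data.Fin.Base using (Fin; zero; suc)
open import Data.Fin.Properties using (sequence)
open import Data.List.Base using (List; []; _∷_)
open import Data.List.Membership.Propositional using () renaming (_∈_ to _∈ᴸ_)
open import Data.List.Relation.Unary.All as All using (All; []; _∷_)
open import Data.Maybe.Base using (Maybe; just; nothing)
open import Data.Maybe.Relation.Unary.All as Maybe using (just; nothing)
open import Data.Nat.Base using (ℕ; zero; suc; _<_; _⊔_; s<s⁻¹)
open import Data.Nat.Properties using (n<1+n; <-≤-trans; m≤m⊔n; m≤n⊔m)
open import Data.Product.Base using (_×_; _,_; proj₁; proj₂; ∃-syntax; Σ-syntax; uncurry)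
open import Data.Sum.Base using (_⊎_; inj₁; inj₂)
open import Effect.Monad using (RawMonad; mkRawMonad)
open import Function.Base using (_on_; _∘_; id)
open import Function.Bundles using (module Equivalence)
open import Relation.Binary.Core using (Rel; _⇒_)
open import Relation.Unary using (Pred; _∈_; _⊆_; _∩_)
open import Defs

open Co using (isCongruence; quotient∈K)

private
  variable
    ℓ k v p : Level
    𝕊 : Signature ℓ

-- Homomorphisms, kernels and the evaluation of terms

module _ {𝕊 : Signature ℓ} {A : Algebra 𝕊} where

  projection : {θ : Rel (Algebra.Carrier A) ℓ} (c : IsCongruence A θ) → Hom A (quotient A c)
  projection c = record
    { to = id ; cong = reflexive ; homo = λ o as → compatible o λ j → reflexive (Algebra.refl A) }
    where open IsCongruence c

infixr 9 _∘ʰ_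

_∘ʰ_ : {A B C : Algebra 𝕊} → Hom B C → Hom A B → Hom A C
_∘ʰ_ {C = C} g f = record
  { to = Hom.to g ∘ Hom.to f
  ; cong = Hom.cong g ∘ Hom.cong f
  ; homo = λ o as → Algebra.trans C (Hom.cong g (Hom.homo f o as)) (Hom.homo g o _)
  }

idʰ : {A : Algebra 𝕊} → Hom A A
idʰ {A = A} = record { to = id ; cong = id ; homo = λ o as → Algebra.refl A }

module _ {A B : Algebra 𝕊} (h : Hom A B) where
  private
    module A = Algebra A
    module B = Algebra B
  open Hom h

  eval-natural : {V : Set v} (ρ : V → A.Carrier) (t : Term 𝕊 V) →
                 to (eval A ρ t) B.≈ eval B (to ∘ ρ) t
  eval-natural ρ (var x _) = B.refl
  eval-natural ρ (op o ts) = B.trans (homo o _) (B.⟦⟧-cong o λ j → eval-natural ρ (ts j))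

  eval-preserves : {V : Set v} (ρ : V → A.Carrier) {e : Equation 𝕊 V} →
                   uncurry (A._≈_ on eval A ρ) e → uncurry (B._≈_ on eval B (to ∘ ρ)) e
  eval-preserves ρ {s , t} e =
    B.trans (B.sym (eval-natural ρ s)) (B.trans (cong e) (eval-natural ρ t))

  kernel-isCongruence : IsCongruence A (B._≈_ on to)
  kernel-isCongruence = record
    { reflexive = cong
    ; isEquivalence = record { refl = B.refl ; sym = B.sym ; trans = B.trans }
    ; compatible = λ o e → B.trans (homo o _) (B.trans (B.⟦⟧-cong o e) (B.sym (homo o _)))
    }

  kernel↪ : Embedding (quotient A kernel-isCongruence) B
  kernel↪ = record { hom = record { to = to ; cong = id ; homo = homo } ; injective = id }

module _ {A B : Algebra 𝕊} (h : Embedding A B) where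
  private
    module B = Algebra B
  open Embedding h

  eval-reflects : {V : Set v} (ρ : V → Algebra.Carrier A) {e : Equation 𝕊 V} →
                  uncurry (B._≈_ on eval B (to ∘ ρ)) e → uncurry (Algebra._≈_ A on eval A ρ) e
  eval-reflects ρ {s , t} e = injective
    (B.trans (eval-natural hom ρ s) (B.trans e (B.sym (eval-natural hom ρ t))))

module _ (A : Algebra 𝕊) where
  open Algebra A

  eval-cong : {V : Set v} {ρ σ : V → Carrier} → (∀ x → ρ x ≈ σ x) →
              (t : Term 𝕊 V) → eval A ρ t ≈ eval A σ t
  eval-cong ρ≈σ (var x _) = ρ≈σ x
  eval-cong ρ≈σ (op o ts) = ⟦⟧-cong o λ j → eval-cong ρ≈σ (ts j)

module _ {𝕊 : Signature ℓ} {A : Algebra 𝕊} {θ : Rel (Algebra.Carrier A) ℓ} (c : IsCongruence A θ)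
         {V : Set v} (ρ : V → Algebra.Carrier A) where
  private π = projection c
  open Algebra (quotient A c) using (sym; trans)

  -- The operations are those of `A`, but on an unspecified term the two evaluations do not compute
  -- to each other, so naturality along `π` is needed.
  quotient⁺ : ∀ e → uncurry (θ on eval A ρ) e → uncurry (θ on eval (quotient A c) ρ) e
  quotient⁺ (s , t) e = trans (sym (eval-natural π ρ s)) (trans e (eval-natural π ρ t))

  quotient⁻ : ∀ e → uncurry (θ on eval (quotient A c) ρ) e → uncurry (θ on eval A ρ) e
  quotient⁻ (s , t) e = trans (eval-natural π ρ s) (trans e (sym (eval-natural π ρ t)))

module _ {𝕊 : Signature ℓ} {V : Set ℓ} where

  -- Since `≋` ignores membership proofs, the valuation must ignore them too.
  interpret : {X : Pred V ℓ} (A : Algebra 𝕊) (β : ∀ x → x ∈ X → Algebra.Carrier A) →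
              (∀ {x} m n → Algebra._≈_ A (β x m) (β x n)) → Hom (FmAlg 𝕊 X) A
  interpret {X} A β β-irrelevant = record { to = ⟪_⟫ ; cong = ⟪⟫-cong ; homo = λ o ts → refl }
    where
    open Algebra A
    ⟪_⟫ : Fm 𝕊 X → Carrier
    ⟪ var x m ⟫ = β x m
    ⟪ op o ts ⟫ = ⟦ o ⟧ λ j → ⟪ ts j ⟫

    ⟪⟫-cong : ∀ {s t} → s ≋ t → ⟪ s ⟫ ≈ ⟪ t ⟫
    ⟪⟫-cong var    = β-irrelevant _ _
    ⟪⟫-cong (op e) = ⟦⟧-cong _ λ j → ⟪⟫-cong (e j)

  occurs⇒∈ : {X : Pred V p} {t : Fm 𝕊 X} {x : V} → Occurs x t → x ∈ X
  occurs⇒∈ (var {m = m}) = m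
  occurs⇒∈ (op j x∈t) = occurs⇒∈ x∈t

-- Bounds on the variables of finitely many equations

fin-bounded : ∀ {n} {P : Fin n → ℕ → Set p} →
              (∀ j → ∃[ N ] (∀ {i} → P j i → i < N)) → ∃[ N ] (∀ j {i} → P j i → i < N)
fin-bounded {n = zero}  b = zero , λ ()
fin-bounded {n = suc n} b with b zero | fin-bounded (b ∘ suc)
... | M , <M | N , <N = M ⊔ N , λ where
  zero    Pi → <-≤-trans (<M Pi) (m≤m⊔n M N)
  (suc j) Pi → <-≤-trans (<N j Pi) (m≤n⊔m M N)

term-bounded : (t : Term 𝕊 ℕ) → ∃[ N ] (∀ {i} → Occurs i t → i < N)
term-bounded (var x _) = suc x , λ { var → n<1+n x }
term-bounded (op o ts) with fin-bounded (term-bounded ∘ ts)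
... | N , <N = N , λ { (op j i∈t) → <N j i∈t }

infix 4 _Bounds_

_Bounds_ : {𝕊 : Signature ℓ} → ℕ → Equation 𝕊 ℕ → Set ℓ
N Bounds (s , t) = ∀ i → Occurs i s ⊎ Occurs i t → i < N

equation-bounded : (e : Equation 𝕊 ℕ) → ∃[ N ] N Bounds e
equation-bounded (s , t) with term-bounded s | term-bounded t
... | M , <M | N , <N = M ⊔ N , λ where
  _ (inj₁ i∈s) → <-≤-trans (<M i∈s) (m≤m⊔n M N)
  _ (inj₂ i∈t) → <-≤-trans (<N i∈t) (m≤n⊔m M N)

equations-bounded : (es : List (Equation 𝕊 ℕ)) → ∃[ N ] All (N Bounds_) es
equations-bounded [] = zero , []
equations-bounded (e ∷ es) with equation-bounded e | equations-bounded es
... | M , <M | N , <N = M ⊔ N ,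
  (λ i i∈e → <-≤-trans (<M i i∈e) (m≤m⊔n M N)) ∷
  All.map (λ <N i i∈e → <-≤-trans (<N i i∈e) (m≤n⊔m M N)) <N

-- Quasivarieties and filters

module _ {𝕊 : Signature ℓ} (F : EquationalFilterPair 𝕊 k) where
  open EquationalFilterPair F

  Q : Pred (QuasiIdentity 𝕊) ℓ
  Q = proj₁ isQuasivariety

  infix 4 _⊩_

  -- The filter of the identity congruence. It involves no element of `Co`, so it can be moved along
  -- homomorphisms and embeddings.
  _⊩_ : (A : Algebra 𝕊) → Algebra.Carrier A → Set ℓ
  A ⊩ a = All (uncurry (Algebra._≈_ A on eval A λ _ → a)) τ

  ⊩-preserved : {A B : Algebra 𝕊} (h : Hom A B) → ∀ {a} → A ⊩ a → B ⊩ Hom.to h a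
  ⊩-preserved h = All.map λ {e} → eval-preserves h _ {e}

  ⊩-reflected : {A B : Algebra 𝕊} (h : Embedding A B) → ∀ {a} → B ⊩ Embedding.to h a → A ⊩ a
  ⊩-reflected h = All.map λ {e} → eval-reflects h _ {e}

  ⊩-resp-≈ : (A : Algebra 𝕊) → ∀ {a b} → Algebra._≈_ A a b → A ⊩ a → A ⊩ b
  ⊩-resp-≈ A a≈b = All.map λ {(s , t)} e →
    trans (eval-cong A (λ _ → sym a≈b) s) (trans e (eval-cong A (λ _ → a≈b) t))
    where open Algebra A

  module _ (A : Algebra 𝕊) where
    open Algebra A using (Carrier)

    module _ (θ : Co K A) where

      i⇒⊩ : ∀ {a} → i A θ a → quotient A (isCongruence θ) ⊩ a
      i⇒⊩ = All.map λ {e} → quotient⁺ (isCongruence θ) _ e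

      ⊩⇒i : ∀ {a} → quotient A (isCongruence θ) ⊩ a → i A θ a
      ⊩⇒i = All.map λ {e} → quotient⁻ (isCongruence θ) _ e

    QuasiClosed : Rel Carrier ℓ → Set ℓ
    QuasiClosed θ = ∀ {qi} → qi ∈ Q → (ρ : ℕ → Carrier) →
      All (uncurry (θ on eval A ρ)) (QuasiIdentity.premises qi) →
      uncurry (θ on eval A ρ) (QuasiIdentity.conclusion qi)

    module _ {θ : Rel Carrier ℓ} (c : IsCongruence A θ) where

      quasiClosed⇒∈K : QuasiClosed θ → quotient A c ∈ K
      quasiClosed⇒∈K closed = Equivalence.from (proj₂ isQuasivariety _) λ qi qi∈Q ρ prem →
        quotient⁺ c ρ (QuasiIdentity.conclusion qi) (closed qi∈Q ρ (All.map (λ {e} → quotient⁻ c ρ e) prem))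

      ∈K⇒quasiClosed : quotient A c ∈ K → QuasiClosed θ
      ∈K⇒quasiClosed A/θ∈K {qi} qi∈Q ρ prem =
        quotient⁻ c ρ (QuasiIdentity.conclusion qi) (Equivalence.to (proj₂ isQuasivariety _) A/θ∈K qi qi∈Q ρ
          (All.map (λ {e} → quotient⁺ c ρ e) prem))

  -- An inductive definition, since the intersection of all suitable elements of Co_K(A)
  -- would live in a higher universe.
  module _ (A : Algebra 𝕊) (Γ : Pred (Algebra.Carrier A) ℓ) where
    open Algebra A using (Carrier; _≈_; ⟦_⟧; refl)

    data Generated : Rel Carrier ℓ where
      generator  : ∀ {a e} → a ∈ Γ → e ∈ᴸ τ → uncurry (Generated on eval A λ _ → a) e
      reflexive  : ∀ {a b} → a ≈ b → Generated a b
      symmetric  : ∀ {a b} → Generated a b → Generated b a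
      transitive : ∀ {a b c} → Generated a b → Generated b c → Generated a c
      compatible : ∀ o {as bs} → (∀ j → Generated (as j) (bs j)) → Generated (⟦ o ⟧ as) (⟦ o ⟧ bs)
      quasi      : ∀ {qi} → qi ∈ Q → (ρ : ℕ → Carrier) →
                   All (uncurry (Generated on eval A ρ)) (QuasiIdentity.premises qi) →
                   uncurry (Generated on eval A ρ) (QuasiIdentity.conclusion qi)

    generated : Co K A
    generated = record
      { rel = Generated
      ; isCongruence = c
      ; quotient∈K = quasiClosed⇒∈K A c quasi
      }
      where
      c : IsCongruence A Generated
      c = record
        { reflexive = reflexive
        ; isEquivalence = record { refl = reflexive refl ; sym = symmetric ; trans = transitive }
        ; compatible = compatible
        }

    ⊆-i-generated : Γ ⊆ i A generated
    ⊆-i-generated a∈Γ = All.tabulate (generator a∈Γ)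

    module _ (θ : Co K A) (Γ⊆iθ : Γ ⊆ i A θ) where
      private
        c = isCongruence θ
        module θ = Algebra (quotient A c)

      mutual
        generated-least : Generated ⇒ rel θ
        generated-least (generator a∈Γ e∈τ) = All.lookup (Γ⊆iθ a∈Γ) e∈τ
        generated-least (reflexive e)    = IsCongruence.reflexive c e
        generated-least (symmetric e)    = θ.sym (generated-least e)
        generated-least (transitive e f) = θ.trans (generated-least e) (generated-least f)
        generated-least (compatible o e) = IsCongruence.compatible c o λ j → generated-least (e j)
        generated-least (quasi qi∈Q ρ es) =
          ∈K⇒quasiClosed A c (quotient∈K θ) qi∈Q ρ (generated-least* es)

        -- Written out in place of `All.map` so that recursion into the premises of `quasi` is
        -- visibly structural.
        generated-least* : ∀ {ρ : ℕ → Carrier} {es} →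
          All (uncurry (Generated on eval A ρ)) es → All (uncurry (rel θ on eval A ρ)) es
        generated-least* []       = []
        generated-least* (e ∷ es) = generated-least e ∷ generated-least* es

      i-generated-least : i A generated ⊆ i A θ
      i-generated-least = All.map generated-least

  module _ {V : Set ℓ} {X : Pred V ℓ} where

    i-isTheory : (θ : Co K (FmAlg 𝕊 X)) → IsTheory (i (FmAlg 𝕊 X) θ)
    i-isTheory θ φ ⊢φ = ⊢φ θ id

    generated-isTheoryGeneratedBy : (Γ : Pred (Fm 𝕊 X) ℓ) →
      IsTheoryGeneratedBy Γ (i (FmAlg 𝕊 X) (generated (FmAlg 𝕊 X) Γ))
    generated-isTheoryGeneratedBy Γ =
      i-isTheory (generated _ Γ) , ⊆-i-generated _ Γ ,
      λ T theory Γ⊆T {φ} φ∈ → theory φ λ θ T⊆iθ →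
        i-generated-least _ Γ θ (λ γ∈Γ → T⊆iθ (Γ⊆T γ∈Γ)) φ∈

  module _ (sub : ClosedUnderSubalgebras K) where

    kernel : {A B : Algebra 𝕊} → Hom A B → B ∈ K → Co K A
    kernel {A} {B} h B∈K = record
      { rel = Algebra._≈_ B on Hom.to h
      ; isCongruence = kernel-isCongruence h
      ; quotient∈K = sub (kernel↪ h) B∈K
      }

    module _ {A B : Algebra 𝕊} (h : Hom A B) (B∈K : B ∈ K) where

      i-kernel⇒⊩ : ∀ {a} → i A (kernel h B∈K) a → B ⊩ Hom.to h a
      i-kernel⇒⊩ a∈ = ⊩-preserved (Embedding.hom (kernel↪ h)) (i⇒⊩ A (kernel h B∈K) a∈)

      ⊩⇒i-kernel : ∀ {a} → B ⊩ Hom.to h a → i A (kernel h B∈K) a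
      ⊩⇒i-kernel a∈ = ⊩⇒i A (kernel h B∈K) (⊩-reflected (kernel↪ h) a∈)

-- Multivalued valuations

module _ {𝕊 : Signature ℓ} {V : Set ℓ} {X : Pred V ℓ} (A : Algebra 𝕊) where
  open Algebra A

  -- A relation and not a function, because membership of a variable in var Γ or var φ cannot be
  -- decided. The equation in `op` lets values pass along homomorphisms, which respect operations
  -- only up to `≈`.
  data Value (R : V → Carrier → Set ℓ) : Fm 𝕊 X → Carrier → Set ℓ where
    var : ∀ {x m a} → R x a → Value R (var x m) a
    op  : ∀ {o ts as a} → (∀ j → Value R (ts j) (as j)) → a ≈ ⟦ o ⟧ as → Value R (op o ts) a

  SingleValued : (V → Carrier → Set ℓ) → Set ℓ
  SingleValued R = ∀ {x a b} → R x a → R x b → a ≈ b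

  module _ {R : V → Carrier → Set ℓ} where

    Value-resp-≋ : ∀ {s t a} → s ≋ t → Value R s a → Value R t a
    Value-resp-≋ var    (var r)   = var r
    Value-resp-≋ (op e) (op rs f) = op (λ j → Value-resp-≋ (e j) (rs j)) f

    Value-unique : SingleValued R → ∀ {t a b} → Value R t a → Value R t b → a ≈ b
    Value-unique unique (var r)   (var s)   = unique r s
    Value-unique unique (op rs e) (op ss f) =
      trans e (trans (⟦⟧-cong _ λ j → Value-unique unique (rs j) (ss j)) (sym f))

    Value-eval : ∀ {N : Set v} {ρ : N → Fm 𝕊 X} {σ : N → Carrier} (t : Term 𝕊 N) →
                 (∀ {n} → Occurs n t → Value R (ρ n) (σ n)) →
                 Value R (eval (FmAlg 𝕊 X) ρ t) (eval A σ t)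
    Value-eval (var n _) r = r var
    Value-eval (op o ts) r = op (λ j → Value-eval (ts j) (r ∘ op j)) refl

Value-map : {𝕊 : Signature ℓ} {V : Set ℓ} {X : Pred V ℓ} {A B : Algebra 𝕊} (h : Hom A B)
  {R : V → Algebra.Carrier A → Set ℓ} {S : V → Algebra.Carrier B → Set ℓ} →
  (∀ {x a} → R x a → S x (Hom.to h a)) →
  {t : Fm 𝕊 X} → ∀ {a} → Value A R t a → Value B S t (Hom.to h a)
Value-map h R⇒S (var r) = var (R⇒S r)
Value-map {B = B} h R⇒S (op rs e) =
  op (λ j → Value-map h R⇒S (rs j)) (Algebra.trans B (Hom.cong h e) (Hom.homo h _ _))

-- Reasoning modulo a fixed goal

module _ {ℓ : Level} (G : Set ℓ) where

  J : Set ℓ → Set ℓ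
  J P = (P → G) → G

  J-monad : RawMonad J
  J-monad = mkRawMonad J (λ x κ → κ x) (λ m f κ → m λ x → f x κ)

  open RawMonad J-monad

  J-excluded-middle : {P : Set ℓ} → J (P ⊎ (P → G))
  J-excluded-middle κ = κ (inj₂ λ p → κ (inj₁ p))

  J-All : {I : Set ℓ} {P : Pred I ℓ} {xs : List I} → All (J ∘ P) xs → J (All P xs)
  J-All []       = pure []
  J-All (p ∷ ps) = p >>= λ p → J-All ps >>= λ ps → pure (p ∷ ps)

  module _ {𝕊 : Signature ℓ} (A : Algebra 𝕊) where
    open Algebra A

    J≈-isCongruence : IsCongruence A (λ a b → J (a ≈ b))
    J≈-isCongruence = record
      { reflexive = pure
      ; isEquivalence = record
        { refl = pure refl
        ; sym = sym <$>_
        ; trans = λ e f → e >>= λ e → trans e <$> f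
        }
      ; compatible = λ o e → ⟦⟧-cong o <$> sequence rawApplicative e
      }

    stabilise : Algebra 𝕊
    stabilise = quotient A J≈-isCongruence

  module _ {𝕊 : Signature ℓ} (F : EquationalFilterPair 𝕊 k) where
    open EquationalFilterPair F

    -- A quasi-identity has finitely many premises, so it can be applied under `J`.
    stabilise∈K : ∀ {A} → A ∈ K → stabilise A ∈ K
    stabilise∈K {A} A∈K = quasiClosed⇒∈K F A (J≈-isCongruence A) λ qi∈Q ρ prem →
      Equivalence.to (proj₂ isQuasivariety A) A∈K _ qi∈Q ρ <$> J-All prem

    stabilise-⊩ : ∀ A {a} → _⊩_ F (stabilise A) a → J (_⊩_ F A a)
    stabilise-⊩ A = J-All ∘ All.map λ {e} → quotient⁻ (J≈-isCongruence A) _ e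

    -- Extension of a partial valuation to all variables

    module Extension {V : Set ℓ} {X : Pred V ℓ} (D : Algebra 𝕊) (D∈K : D ∈ K)
      (stable : ∀ {a b} → J (Algebra._≈_ D a b) → Algebra._≈_ D a b) (d₀ : Algebra.Carrier D)
      (R : V → Algebra.Carrier D → Set ℓ) (R-unique : SingleValued {X = X} D R) where
      open Algebra D

      private
        FX : Algebra 𝕊
        FX = FmAlg 𝕊 X

      -- Variables without a value receive the default `d₀`. Absence is negation relative to `G`, so
      -- a clash of the two cases yields `G`, which `stable` turns into the required equation.
      R̂ : V → Carrier → Set ℓ
      R̂ x d = R x d ⊎ ((∀ d′ → R x d′ → G) × d ≈ d₀)

      R̂-unique : SingleValued {X = X} D R̂
      R̂-unique (inj₁ r)        (inj₁ s)        = R-unique r s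
      R̂-unique (inj₁ r)        (inj₂ (¬s , _)) = stable λ _ → ¬s _ r
      R̂-unique (inj₂ (¬r , _)) (inj₁ s)        = stable λ _ → ¬r _ s
      R̂-unique (inj₂ (_ , e))  (inj₂ (_ , f))  = trans e (sym f)

      R̂-total : ∀ x → J (∃[ d ] R̂ x d)
      R̂-total x = J-excluded-middle {∃[ d ] R x d} >>= λ where
        (inj₁ (d , r)) → pure (d , inj₁ r)
        (inj₂ ¬r)      → pure (d₀ , inj₂ ((λ d r → ¬r (d , r)) , refl))

      Val : Fm 𝕊 X → Carrier → Set ℓ
      Val = Value D R̂

      Val-unique : ∀ {t a b} → Val t a → Val t b → a ≈ b
      Val-unique = Value-unique D R̂-unique

      Val-total : ∀ t → J (∃[ d ] Val t d)
      Val-total (var x _) = R̂-total x >>= λ (d , r) → pure (d , var r)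
      Val-total (op o ts) = sequence rawApplicative (λ j → Val-total (ts j)) >>= λ ds →
        pure (_ , op (proj₂ ∘ ds) refl)

      -- `J` need not commute with products over `ℕ`, so values are chosen one at a time and only
      -- below the bound; from `N` on, `σ` is `d₀`.
      Val-assign : ∀ N (ρ : ℕ → Fm 𝕊 X) → J (Σ[ σ ∈ (ℕ → Carrier) ] (∀ {n} → n < N → Val (ρ n) (σ n)))
      Val-assign zero    ρ = pure ((λ _ → d₀) , λ ())
      Val-assign (suc N) ρ = Val-total (ρ zero) >>= λ where
        (d , r) → Val-assign N (ρ ∘ suc) >>= λ where
          (σ , rs) → pure ((λ { zero → d ; (suc n) → σ n }) ,
                           λ { {zero} _ → r ; {suc n} n<N → rs (s<s⁻¹ n<N) })

      -- The kernel of the extended valuation. It quantifies over all values because their existence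
      -- is known only modulo `J`.
      _∼_ : Rel (Fm 𝕊 X) ℓ
      s ∼ t = ∀ a b → Val s a → Val t b → a ≈ b

      ∼-isCongruence : IsCongruence FX _∼_
      ∼-isCongruence = record
        { reflexive = λ e _ _ r s → Val-unique (Value-resp-≋ D e r) s
        ; isEquivalence = record
          { refl  = λ _ _ → Val-unique
          ; sym   = λ e a b r s → sym (e b a s r)
          -- The middle term has a value only modulo `J`; stability of equality in `D` removes the
          -- `J`.
          ; trans = λ {_} {t} e f a b r s → stable
              (Val-total t >>= λ (m , q) → pure (trans (e a m r q) (f m b q s)))
          }
        ; compatible = λ { o e _ _ (op rs f) (op ss g) →
            trans f (trans (⟦⟧-cong o λ j → e j _ _ (rs j) (ss j)) (sym g)) }
        }

      ∼-quasiClosed : QuasiClosed F FX _∼_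
      ∼-quasiClosed {qi} qi∈Q ρ prem a b r s
        with equations-bounded (QuasiIdentity.conclusion qi ∷ QuasiIdentity.premises qi)
      ... | N , concl<N ∷ prem<N = stable (Val-assign N ρ >>= λ where
        (σ , val) →
          let (lhs , rhs) = QuasiIdentity.conclusion qi
              value : (t : Term 𝕊 ℕ) → (∀ {n} → Occurs n t → n < N) → Val (eval FX ρ t) (eval D σ t)
              value t t<N = Value-eval D t (val ∘ t<N)
          -- The premises hold in `D` at `σ` by the definition of `∼`; uniqueness of values carries
          -- the conclusion at `σ` back to `a` and `b`.
          in pure (trans (Val-unique r (value lhs (concl<N _ ∘ inj₁))) (trans
            (Equivalence.to (proj₂ isQuasivariety D) D∈K qi qi∈Q σ
              (All.zipWith (λ {(l , r)} (e , <N) →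
                e _ _ (value l (<N _ ∘ inj₁)) (value r (<N _ ∘ inj₂))) (prem , prem<N)))
            (Val-unique (value rhs (concl<N _ ∘ inj₂)) s))))

      ∼-Co : Co K FX
      ∼-Co = record
        { rel = _∼_
        ; isCongruence = ∼-isCongruence
        ; quotient∈K = quasiClosed⇒∈K F _ ∼-isCongruence ∼-quasiClosed
        }

      -- `Γ ⊢ φ` is applied to the kernel `∼`: a formula with one true value lies in its filter, and
      -- every value of a formula in the filter is true.
      ⊢-sound : ∀ {Γ φ d} → Γ ⊢ φ →
                (∀ {γ} → γ ∈ Γ → ∃[ c ] (Value D R γ c × _⊩_ F D c)) →
                Value D R φ d → _⊩_ F D d
      ⊢-sound {φ = φ} {d} Γ⊢φ Γ-true φ-value = All.map
        (λ {(s , t)} e → e _ _ (value s φ-value) (value t φ-value))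
        (Γ⊢φ ∼-Co λ γ∈Γ → let (c , γ-value , c-true) = Γ-true γ∈Γ in
          All.map (λ {(s , t)} e _ _ r r′ →
            trans (Val-unique r (value s γ-value)) (trans e (Val-unique (value t γ-value) r′)))
            c-true)
        where
        value : ∀ {χ c} (t : Term 𝕊 _) → Value D R χ c → Val (eval FX (λ _ → χ) t) (eval D (λ _ → c) t)
        value t χ-value = Value-eval D t λ _ → Value-map idʰ inj₁ χ-value

    -- In an amalgam over `A`, the valuations `R` and `S` agree wherever both are defined, since
    -- shared values come from `A`. Glued together they make Γ true, hence φ, and truth of φ is
    -- reflected to `C`.
    amalgamate : Amalgamation K → {V : Set ℓ} {X : Pred V ℓ} {A B C : Algebra 𝕊} →
      A ∈ K → B ∈ K → C ∈ K → (f : Embedding A B) (g : Embedding A C)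
      (R : V → Algebra.Carrier B → Set ℓ) (S : V → Algebra.Carrier C → Set ℓ) →
      SingleValued {X = X} B R → SingleValued {X = X} C S →
      (∀ {x b c} → R x b → S x c →
        ∃[ a ] (Algebra._≈_ B (Embedding.to f a) b × Algebra._≈_ C (Embedding.to g a) c)) →
      {Γ : Pred (Fm 𝕊 X) ℓ} {φ : Fm 𝕊 X} → Γ ⊢ φ →
      (∀ {γ} → γ ∈ Γ → ∃[ b ] (Value B R γ b × _⊩_ F B b)) →
      ∀ {c} → Value C S φ c → J (_⊩_ F C c)
    amalgamate amalg {V} {X} {A} {B} {C} A∈K B∈K C∈K f g R S R-unique S-unique common
      {φ = φ} Γ⊢φ Γ-true {c} φ-value
      with amalg A∈K B∈K C∈K f g
    ... | D , e , e′ , D∈K , commutes =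
      -- The map from `C` to the stabilised amalgam need not be injective, so truth is first pulled
      -- back to `D` modulo `J`.
      ⊩-reflected F e′ <$> stabilise-⊩ D (Extension.⊢-sound (stabilise D) (stabilise∈K D∈K)
        -- The value of φ serves as the default, an element being needed although carriers may be
        -- empty.
        join (eC.to c) T (λ {x} → T-unique {x}) Γ⊢φ
        (λ γ∈Γ → let (b , γ-value , b-true) = Γ-true γ∈Γ in
          eB.to b , Value-map eB T-left γ-value , ⊩-preserved F eB b-true)
        (Value-map eC T-right φ-value))
      where
      module D = Algebra D
      π = projection (J≈-isCongruence D)
      eB = π ∘ʰ Embedding.hom e
      eC = π ∘ʰ Embedding.hom e′
      module eB = Hom eB
      module eC = Hom eC

      join : ∀ {P} → J (J P) → J P
      join = _>>= id

      open Algebra (stabilise D) using (_≈_; refl; sym; trans)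

      T : V → D.Carrier → Set ℓ
      T x d = (∃[ b ] (R x b × eB.to b ≈ d)) ⊎ (∃[ c ] (S x c × eC.to c ≈ d))

      T-left : ∀ {x b} → R x b → T x (eB.to b)
      T-left r = inj₁ (_ , r , refl)

      T-right : ∀ {x c} → S x c → T x (eC.to c)
      T-right s = inj₂ (_ , s , refl)

      meet : ∀ {x b c} → R x b → S x c → eB.to b ≈ eC.to c
      meet r s = let (a , fa≈b , ga≈c) = common r s in
        trans (sym (eB.cong fa≈b)) (trans (pure (commutes a)) (eC.cong ga≈c))

      T-unique : SingleValued {X = X} (stabilise D) T
      T-unique (inj₁ (_ , r , e)) (inj₁ (_ , r′ , e′)) = trans (sym e) (trans (eB.cong (R-unique r r′)) e′)
      T-unique (inj₁ (_ , r , e)) (inj₂ (_ , s , e′))  = trans (sym e) (trans (meet r s) e′)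
      T-unique (inj₂ (_ , s , e)) (inj₁ (_ , r , e′))  = trans (sym e) (trans (sym (meet r s)) e′)
      T-unique (inj₂ (_ , s , e)) (inj₂ (_ , s′ , e′)) = trans (sym e) (trans (eC.cong (S-unique s s′)) e′)

-- Interpolation

module Interpolation {𝕊 : Signature ℓ} (F : EquationalFilterPair 𝕊 k)
  (sub : ClosedUnderSubalgebras (EquationalFilterPair.K F))
  (lifting : EquationalFilterPair.TheoryLifting F)
  (amalg : Amalgamation (EquationalFilterPair.K F))
  {V : Set ℓ} {X : Pred V ℓ} (Γ : Pred (Fm 𝕊 X) ℓ) (φ : Fm 𝕊 X)
  (Γ⊢φ : EquationalFilterPair._⊢_ F Γ φ) where

  open EquationalFilterPair F

  W₁ W₂ : Pred V ℓ
  W₁ = varsOf Γ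
  W₂ = varOf φ

  W₁⊆X : W₁ ⊆ X
  W₁⊆X (_ , _ , x∈γ) = occurs⇒∈ x∈γ

  FX : Algebra 𝕊
  FX = FmAlg 𝕊 X

  ⟨Γ⟩ : Co K FX
  ⟨Γ⟩ = generated F FX Γ

  -- Lying in the filter of `⟨Γ⟩` amounts to following from Γ, but unlike `Γ ⊢ ψ` it is a predicate
  -- at level `ℓ`.
  interpolant : Pred (Fm 𝕊 X) ℓ
  interpolant ψ = varOf ψ ⊆ W₁ ∩ W₂ × ψ ∈ i FX ⟨Γ⟩

  CommonFormula : Set ℓ
  CommonFormula = Σ[ c ∈ Fm 𝕊 X ] (varOf c ⊆ W₁ ∩ W₂)

  module _ (θ : Co K FX) (interpolant⊆iθ : interpolant ⊆ i FX θ) where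

    private
      G : Set ℓ
      G = φ ∈ i FX θ

      FX/Γ FX/θ : Algebra 𝕊
      FX/Γ = quotient FX (isCongruence ⟨Γ⟩)
      FX/θ = quotient FX (isCongruence θ)

      π/Γ : Hom FX FX/Γ
      π/Γ = projection (isCongruence ⟨Γ⟩)

      π/θ : Hom FX FX/θ
      π/θ = projection (isCongruence θ)

      Γ-true : ∀ {γ} → γ ∈ Γ → _⊩_ F FX/Γ γ
      Γ-true γ∈Γ = i⇒⊩ F FX ⟨Γ⟩ (⊆-i-generated F FX Γ γ∈Γ)

    module NoCommonFormula (none : CommonFormula → G) where

      B C : Algebra 𝕊
      B = stabilise G FX/Γ
      C = stabilise G FX/θ

      -- The empty algebra modulo `G`. A literally empty carrier could not interpret constants,
      -- whose absence is known only relative to `G`.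
      common : Algebra 𝕊
      common = record
        { setoid = record
          { Carrier = CommonFormula
          ; _≈_ = Algebra._≈_ B on proj₁
          ; isEquivalence = record
            { refl = λ {a} → Algebra.refl B {proj₁ a}
            ; sym = λ {a} {b} → Algebra.sym B {proj₁ a} {proj₁ b}
            ; trans = λ {a} {b} {c} → Algebra.trans B {proj₁ a} {proj₁ b} {proj₁ c}
            }
          }
        ; ⟦_⟧ = λ o as → op o (proj₁ ∘ as) , λ { (op j x∈) → proj₂ (as j) x∈ }
        ; ⟦⟧-cong = λ o e → Algebra.⟦⟧-cong B o e
        }

      common↪B : Embedding common B
      common↪B = record
        { hom = record { to = proj₁ ; cong = id ; homo = λ o as → Algebra.refl B {op o (proj₁ ∘ as)} }
        ; injective = id
        }

      common↪C : Embedding common C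
      common↪C = record
        { hom = record
          { to = proj₁
          -- An element of the carrier yields `G`, and `G` proves every equation of the stabilised
          -- algebra `C`.
          ; cong = λ {a} _ _ → none a
          ; homo = λ o as → Algebra.refl C {op o (proj₁ ∘ as)}
          }
        ; injective = λ {a} _ _ → none a
        }

      Variable : (D : Algebra 𝕊) → Hom FX D → Pred V ℓ → V → Algebra.Carrier D → Set ℓ
      Variable D h W x d = x ∈ W × Σ[ m ∈ x ∈ X ] Algebra._≈_ D d (Hom.to h (var x m))

      Variable-unique : ∀ D h W → SingleValued {X = X} D (Variable D h W)
      Variable-unique D h W (_ , _ , e) (_ , _ , f) = trans e (trans (Hom.cong h var) (sym f))
        where open Algebra D

      Variable-value : ∀ D h W t → varOf t ⊆ W → Value D (Variable D h W) t (Hom.to h t)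
      Variable-value D h W (var x m) t⊆W = var (t⊆W var , m , Algebra.refl D)
      Variable-value D h W (op o ts) t⊆W =
        op (λ j → Variable-value D h W (ts j) (t⊆W ∘ op j)) (Hom.homo h o ts)

      hB : Hom FX B
      hB = projection (J≈-isCongruence G FX/Γ) ∘ʰ π/Γ

      hC : Hom FX C
      hC = projection (J≈-isCongruence G FX/θ) ∘ʰ π/θ

      φ-true : G
      φ-true = amalgamate G F amalg
        (sub common↪B B∈K) B∈K (stabilise∈K G F (quotient∈K θ)) common↪B common↪C
        (Variable B hB W₁) (Variable C hC W₂)
        (Variable-unique B hB W₁) (Variable-unique C hC W₂)
        (λ { {x} (x∈W₁ , m , e) (x∈W₂ , n , f) →
          (var x m , λ { var → x∈W₁ , x∈W₂ }) , Algebra.sym B e ,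
          Algebra.sym C (Algebra.trans C f (Hom.cong hC var)) })
        Γ⊢φ
        (λ {γ} γ∈Γ → γ , Variable-value B hB W₁ γ (λ x∈γ → γ , γ∈Γ , x∈γ) ,
          ⊩-preserved F (projection (J≈-isCongruence G FX/Γ)) (Γ-true γ∈Γ))
        (Variable-value C hC W₂ φ id)
        -- The goal is `G` itself, so the result modulo `J` is consumed by a continuation into `G`.
        (λ φ-true → stabilise-⊩ G F FX/θ φ-true (⊩⇒i F FX θ))
        where
        B∈K : B ∈ K
        B∈K = stabilise∈K G F (quotient∈K ⟨Γ⟩)

    -- The fresh variable nothing makes the theory lifting property applicable even
    -- when the formula c shared by W₁ and W₂ is closed; it is then replaced by c.
    module WithCommonFormula (c : Fm 𝕊 X) (c⊆ : varOf c ⊆ W₁ ∩ W₂) where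

      module _ {W : Pred V ℓ} (W⊆X : W ⊆ X) where

        substitution : Hom (FmAlg 𝕊 (Maybe.All W)) FX
        substitution = interpret FX β (λ {x} → β-irrelevant {x})
          where
          β : ∀ x → x ∈ Maybe.All W → Fm 𝕊 X
          β (just x) (just m) = var x (W⊆X m)
          β nothing  _        = c

          β-irrelevant : ∀ {x} m n → β x m ≋ β x n
          β-irrelevant (just _) (just _) = var
          β-irrelevant nothing  nothing  = Algebra.refl FX

        module _ (ψ : Co K (FmAlg 𝕊 (Maybe.All W))) where

          private
            D : Algebra 𝕊
            D = quotient (FmAlg 𝕊 (Maybe.All W)) (isCongruence ψ)

          Variable : V → Algebra.Carrier D → Set ℓ
          Variable x d = Σ[ m ∈ x ∈ W ] rel ψ d (var (just x) (just m))

          Variable-unique : SingleValued {X = X} D Variable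
          Variable-unique (_ , e) (_ , f) =
            trans e (trans (IsCongruence.reflexive (isCongruence ψ) var) (sym f))
            where open Algebra D

          -- The witness is `t` itself with its membership proofs rebuilt; the fresh variable does
          -- not occur in it, so substitution gives `t` back.
          Variable-value : ∀ t → varOf t ⊆ W →
            ∃[ d ] (Value D Variable t d × Hom.to substitution d ≋ t)
          Variable-value (var x m) t⊆W = _ , var (t⊆W var , Algebra.refl D) , var
          Variable-value (op o ts) t⊆W =
            op o (λ j → proj₁ (ds j)) ,
            op (λ j → proj₁ (proj₂ (ds j))) (Algebra.refl D) ,
            op (λ j → proj₂ (proj₂ (ds j)))
            where
            ds = λ j → Variable-value (ts j) (t⊆W ∘ op j)

      X₁ X₂ : Pred (Maybe V) ℓ
      X₁ = Maybe.All W₁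
      X₂ = Maybe.All W₂

      σ₁ : Hom (FmAlg 𝕊 X₁) FX
      σ₁ = substitution W₁⊆X

      σ₂ : Hom (FmAlg 𝕊 X₂) FX
      σ₂ = substitution (occurs⇒∈ {t = φ})

      σ-agree : (t : Fm 𝕊 (X₁ ∩ X₂)) → Hom.to σ₁ (incl proj₁ t) ≋ Hom.to σ₂ (incl proj₂ t)
      σ-agree (var (just x) (just _ , just _))   = var
      σ-agree (var nothing  (nothing , nothing)) = Algebra.refl FX
      σ-agree (op o ts) = op λ j → σ-agree (ts j)

      -- Replacing the fresh variable by `c` introduces only shared variables, so instances that
      -- follow from Γ belong to the interpolant.
      σ-vars : (t : Fm 𝕊 (X₁ ∩ X₂)) → varOf (Hom.to σ₁ (incl proj₁ t)) ⊆ W₁ ∩ W₂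
      σ-vars (var (just x) (just m , just n)) var = m , n
      σ-vars (var nothing  (nothing , nothing)) x∈c = c⊆ x∈c
      σ-vars (op o ts) (op j x∈) = σ-vars (ts j) x∈

      -- Its filter is the theory of all formulas over `X₁` whose instances under `σ₁` follow from
      -- Γ.
      T : Co K (FmAlg 𝕊 X₁)
      T = kernel F sub (π/Γ ∘ʰ σ₁) (quotient∈K ⟨Γ⟩)

      S : Pred (Fm 𝕊 X₂) ℓ
      S y = ∃[ t ] (incl proj₁ t ∈ i (FmAlg 𝕊 X₁) T × incl proj₂ t ≋ y)

      T′ : Co K (FmAlg 𝕊 X₂)
      T′ = generated F (FmAlg 𝕊 X₂) S

      pullback : Co K (FmAlg 𝕊 X₂)
      pullback = kernel F sub (π/θ ∘ʰ σ₂) (quotient∈K θ)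

      -- The assumption on `θ` enters here: an instance of a shared formula in the theory of `T`
      -- lies in the interpolant, hence in the filter of `θ`, and `σ₁` and `σ₂` give the same
      -- instance.
      S⊆pullback : S ⊆ i (FmAlg 𝕊 X₂) pullback
      S⊆pullback (t , t∈T , e) = ⊩⇒i-kernel F sub (π/θ ∘ʰ σ₂) (quotient∈K θ)
        (⊩-resp-≈ F FX/θ (Hom.cong π/θ (Algebra.trans FX (σ-agree t) (Hom.cong σ₂ e)))
          (i⇒⊩ F FX θ (interpolant⊆iθ
            (σ-vars t , ⊩⇒i F FX ⟨Γ⟩ (i-kernel⇒⊩ F sub (π/Γ ∘ʰ σ₁) (quotient∈K ⟨Γ⟩) t∈T)))))

      φ-true : G
      φ-true
        with lifting (Maybe V) X₁ X₂ (nothing , nothing , nothing)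
               (i _ T) (i-isTheory F T) (i _ T′) (generated-isTheoryGeneratedBy F S)
      ... | θ₁ , θ₀ , θ₂ , T≐ , T′≐ , _ , θ₁↔θ₀ , θ₀↔θ₂ =
        let (φ₂ , φ-value , σ₂φ₂≋φ) = Variable-value _ θ₂ φ id in
        amalgamate G F amalg (quotient∈K θ₀) (quotient∈K θ₁) (quotient∈K θ₂) ι₁ ι₂
          (Variable W₁⊆X θ₁) (Variable (occurs⇒∈ {t = φ}) θ₂)
          (Variable-unique W₁⊆X θ₁) (Variable-unique (occurs⇒∈ {t = φ}) θ₂)
          (λ { {x} (m , e) (n , f) → var (just x) (just m , just n) ,
            Algebra.sym F₁ e , Algebra.sym F₂ f })
          Γ⊢φ
          (λ {γ} γ∈Γ →
            let (γ₁ , γ-value , σ₁γ₁≋γ) = Variable-value W₁⊆X θ₁ γ (λ x∈γ → γ , γ∈Γ , x∈γ) in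
            γ₁ , γ-value , i⇒⊩ F _ θ₁ (proj₁ T≐ (⊩⇒i-kernel F sub (π/Γ ∘ʰ σ₁) (quotient∈K ⟨Γ⟩)
              (⊩-resp-≈ F FX/Γ (Hom.cong π/Γ (Algebra.sym FX σ₁γ₁≋γ)) (Γ-true γ∈Γ)))))
          φ-value
          -- Truth of `φ₂` puts it in the theory generated by `S`, hence in the filter of
          -- `pullback`; applying `σ₂` then recovers φ in the filter of `θ`.
          (λ φ₂-true → ⊩⇒i F FX θ (⊩-resp-≈ F FX/θ (Hom.cong π/θ σ₂φ₂≋φ)
            (i-kernel⇒⊩ F sub (π/θ ∘ʰ σ₂) (quotient∈K θ)
              (i-generated-least F _ S pullback S⊆pullback (proj₂ T′≐ (⊩⇒i F _ θ₂ φ₂-true))))))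
        where
        F₀ F₁ F₂ : Algebra 𝕊
        F₀ = quotient (FmAlg 𝕊 (X₁ ∩ X₂)) (isCongruence θ₀)
        F₁ = quotient (FmAlg 𝕊 X₁) (isCongruence θ₁)
        F₂ = quotient (FmAlg 𝕊 X₂) (isCongruence θ₂)

        -- The two inclusions between `θ₀` and the restriction of `θ₁` say that the map is well
        -- defined and injective.
        ι₁ : Embedding F₀ F₁
        ι₁ = record
          { hom = record { to = incl proj₁ ; cong = proj₂ θ₁↔θ₀ ; homo = λ o as → Algebra.refl F₁ }
          ; injective = proj₁ θ₁↔θ₀
          }

        ι₂ : Embedding F₀ F₂
        ι₂ = record
          { hom = record { to = incl proj₂ ; cong = proj₁ θ₀↔θ₂ ; homo = λ o as → Algebra.refl F₂ }
          ; injective = proj₂ θ₀↔θ₂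
          }

    interpolant-entails : φ ∈ i FX θ
    interpolant-entails = J-excluded-middle G {CommonFormula} λ where
      (inj₁ (c , c⊆)) → WithCommonFormula.φ-true c c⊆
      (inj₂ none)     → NoCommonFormula.φ-true none

theorem5p5 : ∀ {ℓ k : Level} (𝕊 : Signature ℓ) (F : EquationalFilterPair 𝕊 k) →
    let open EquationalFilterPair F in
    ClosedUnderSubalgebras K →
    TheoryLifting →
    Amalgamation K →
    ∀ {V : Set ℓ} (X : Pred V ℓ) → CraigInterpolation (_⊢_ {X = X})
theorem5p5 𝕊 F sub lifting amalg X Γ φ Γ⊢φ =
  interpolant , (λ (_ , (ψ⊆ , _) , x∈ψ) → ψ⊆ x∈ψ) ,
  (λ ψ (_ , ψ∈) θ Γ⊆iθ → i-generated-least F _ Γ θ Γ⊆iθ ψ∈) ,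
  interpolant-entails
  where open Interpolation F sub lifting amalg Γ φ Γ⊢φ
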